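{- Let $\mathbb{K}$ and $\mathbb{K}'$ be finite near-fields with $V=V_{\mathbb{K}}=V_{\mathbb{K}'}$, and let $\mathcal{C}$ and $\mathcal{C}'$ be imprimitive cyclotomic schemes over $\mathbb{K}$ and $\mathbb{K}'$ respectively. Then $\mathcal{C}$ and $\mathcal{C}'$ are isomorphic if and only if their base groups are conjugate in $\mathrm{GL}(V)$. Moreover, if $G$ is the base group of $\mathcal{C}$ and $T$ is the translation group of $V$, then $\overline{G}=G$ and $\mathrm{Aut}(\mathcal{C})=TG$.
   Context: A (right) near-field is $\mathbb{K}=(\mathbb{K},+,\circ)$ such that $\mathbb{K}^+=(\mathbb{K},+)$ is a group with neutral element $0$, $\mathbb{K}^\times=(\mathbb{K}\setminus\{0\},\circ)$ is a group, $x\circ 0=0$ for all $x$, and $(x+y)\circ z=x\circ z+y\circ z$ for all $x,y,z\in\mathbb{K}$. If $\mathbb{K}$ is finite, $\mathbb{K}^+$ is elementary abelian and is identified with the additive group of a linear space $V_{\mathbb{K}}$ over the prime field contained in the center of $\mathbb{K}$. Here $V_{\mathbb K}=V_{\mathbb K'}$ means that the two near-fields have the same underlying set, the same additive group, and hence the same associated linear space. For a subgroup $K\le\mathbb{K}^\times$, the cyclotomic scheme $\mathrm{Cyc}(K,\mathbb{K})$ is the association scheme $(\mathbb{K},\{R_a\}_{a\in\mathbb{K}})$ with $R_a=\{(x,y)\in\mathbb{K}^2: y-x\in a\circ K\}$. Its base group is the subgroup $\{x\mapsto x\circ b: b\in K\}$ of $\mathrm{GL}(V_{\mathbb{K}})$.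 A scheme $(V,\mathcal{R})$ is imprimitive if there is an equivalence relation $E$ on $V$ that is a union of elements of $\mathcal{R}$, with $E$ neither the diagonal nor $V^2$. Schemes $\mathcal{C}=(V,\mathcal{R})$ and $\mathcal{C}'=(V',\mathcal{R}')$ are isomorphic if there is a bijection $f:V\to V'$ with $\{R^f:R\in\mathcal{R}\}=\mathcal{R}'$, where $R^f=\{(u^f,v^f):(u,v)\in R\}$; $\mathrm{Aut}(\mathcal{C})=\{g\in\mathrm{Sym}(V):R^g=R\text{ for all }R\in\mathcal{R}\}$. For $G\le\mathrm{GL}(V)$, the linear closure $\overline{G}$ is the largest subgroup of $\mathrm{GL}(V)$ having the same orbits on $V$ as $G$. The translation group is $T=\{x\mapsto x+c: c\in V\}\le\mathrm{Sym}(V)$. -}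

module Defs where

open import Algebra.Bundles using (Group)
open import Algebra.Core using (Op₁; Op₂)
open import Algebra.Structures using (IsGroup)
import Algebra.Definitions.RawMonoid as RawMonoidDefinitions
open import Data.Fin.Base using (Fin)
open import Data.Nat.Base using (ℕ)
open import Data.Product.Base using (Σ; ∃; ∃₂; _×_; _,_; proj₁; proj₂)
open import Function.Base using (_on_)
open import Function.Bundles using (_↔_; Inverse; mk↔ₛ′)
open import Function.Construct.Composition using (_↔-∘_)
open import Function.Construct.Identity using (↔-id)
open import Function.Construct.Symmetry using (↔-sym)
open import Level using (Level; _⊔_; suc)
open import Relation.Binary.Core using (Rel; _⇔_)
open import Relation.Binary.Definitions using (_Respects_)
open import Relation.Binary.PropositionalEquality
  using (_≡_; _≢_; _≗_; refl; sym; trans; cong)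
open import Relation.Binary.Structures using (IsEquivalence)
open import Relation.Nullary.Negation using (¬_)
open import Relation.Unary using (Pred; _∈_; _⊆_; _≐_)

open Inverse using (to; from; strictlyInverseˡ; strictlyInverseʳ)

private
  variable
    a ℓ : Level

Finite : Set ℓ → Set ℓ
Finite A = ∃ λ n → A ↔ Fin n

module _ (𝔾 : Group a ℓ) where

  open Group 𝔾

  record IsSubgroup {p} (H : Pred Carrier p) : Set (a ⊔ ℓ ⊔ p) where
    field
      resp      : H Respects _≈_
      ε-closed  : ε ∈ H
      ∙-closed  : ∀ {x y} → x ∈ H → y ∈ H → (x ∙ y) ∈ H
      ⁻¹-closed : ∀ {x} → x ∈ H → (x ⁻¹) ∈ H

  setProduct : ∀ {p q} → Pred Carrier p → Pred Carrier q → Pred Carrier _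
  setProduct H L x = ∃₂ λ h l → h ∈ H × l ∈ L × x ≈ h ∙ l

  conjugate : ∀ {p} → Pred Carrier p → Carrier → Pred Carrier _
  conjugate H g x = ∃ λ h → h ∈ H × x ≈ g ⁻¹ ∙ h ∙ g

-- Permutations act on the right: f ∙ g is "first f, then g".
Sym : Set ℓ → Group ℓ ℓ
Sym V = record
  { Carrier = V ↔ V
  ; _≈_     = _≗_ on to
  ; _∙_     = λ f g → g ↔-∘ f
  ; ε       = ↔-id V
  ; _⁻¹     = ↔-sym
  ; isGroup = record
    { isMonoid = record
      { isSemigroup = record
        { isMagma = record
          { isEquivalence = record
            { refl  = λ _ → refl
            ; sym   = λ p x → sym (p x)
            ; trans = λ p q x → trans (p x) (q x)
            }
          ; ∙-cong = λ {_} {f′} {g} p q x → trans (cong (to g) (p x)) (q (to f′ x))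
          }
        ; assoc = λ _ _ _ _ → refl
        }
      ; identity = (λ _ _ → refl) , (λ _ _ → refl)
      }
    ; inverse = strictlyInverseˡ , strictlyInverseʳ
    ; ⁻¹-cong = λ {f} {g} p x →
        trans (sym (strictlyInverseʳ g (from f x)))
          (cong (from g)
            (trans (sym (p (from f x))) (strictlyInverseˡ f x)))
    }
  }

orbit : {V : Set ℓ} → Pred (V ↔ V) ℓ → V → Pred V ℓ
orbit H u v = ∃ λ h → h ∈ H × to h u ≡ v

-- The pair (V, 𝓡) underlying an association scheme, with 𝓡 given as a family
-- of relations in which repetitions are allowed.  The axioms of an association
-- scheme play no role in imprimitivity, isomorphism or Aut.
record Scheme (V : Set ℓ) : Set (suc ℓ) where
  field
    Index : Set ℓ
    R     : Index → Rel V ℓ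

image : {V V′ : Set ℓ} → V ↔ V′ → Rel V ℓ → Rel V′ ℓ
image f S x y = ∃₂ λ u v → S u v × to f u ≡ x × to f v ≡ y

module _ {V : Set ℓ} (𝒞 : Scheme V) where

  open Scheme 𝒞

  record Imprimitive : Set (suc ℓ) where
    field
      E             : Rel V ℓ
      isEquivalence : IsEquivalence E
      I             : Pred Index ℓ
      E-union       : E ⇔ (λ x y → ∃ λ i → i ∈ I × R i x y)
      E≢diagonal    : ¬ (E ⇔ _≡_)
      E≢V²          : ¬ (∀ x y → E x y)

  Aut : Pred (V ↔ V) ℓ
  Aut g = ∀ i → image g (R i) ⇔ R i

-- The two conditions on f say that the sets { Rᶠ : R ∈ 𝓡 } and 𝓡′ are equal.
Isomorphic : {V V′ : Set ℓ} → Scheme V → Scheme V′ → Set ℓ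
Isomorphic {V = V} {V′} 𝒞 𝒞′ = Σ (V ↔ V′) λ f →
    (∀ i → ∃ λ j → image f (R 𝒞 i) ⇔ R 𝒞′ j)
  × (∀ j → ∃ λ i → image f (R 𝒞 i) ⇔ R 𝒞′ j)
  where open Scheme

module _ {V : Set ℓ} {_+_ : Op₂ V} {0# : V} { -_ : Op₁ V}
         (V⁺ : IsGroup _≡_ _+_ 0# -_) where

  -- A near-field whose additive group is V⁺.
  record NearField : Set ℓ where

    V≢0 : Set ℓ
    V≢0 = Σ V (_≢ 0#)

    field
      _∘_      : Op₂ V
      ∘-closed : ∀ {x y} → x ≢ 0# → y ≢ 0# → (x ∘ y) ≢ 0#
      1×       : V≢0
      _⁻¹×     : Op₁ V≢0

    _∘×_ : Op₂ V≢0
    (x , x≢0) ∘× (y , y≢0) = x ∘ y , ∘-closed x≢0 y≢0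

    field
      ×-isGroup : IsGroup (_≡_ on proj₁) _∘×_ 1× _⁻¹×
      zeroʳ     : ∀ x → x ∘ 0# ≡ 0#
      distribʳ  : ∀ x y z → (x + y) ∘ z ≡ (x ∘ z) + (y ∘ z)

    ×-group : Group ℓ ℓ
    ×-group = record { isGroup = ×-isGroup }

  -- The prime field of a near-field over V⁺ consists of the multiples m · 1,
  -- and (m · 1) ∘ x = m · x; so the linear structure of V depends on V⁺ only,
  -- the scalar m acting as the m-fold sum.
  _·_ : ℕ → V → V
  _·_ = RawMonoidDefinitions._×_ (Group.rawMonoid (record { isGroup = V⁺ }))

  record GL (g : V ↔ V) : Set ℓ where
    field
      additive    : ∀ x y → to g (x + y) ≡ to g x + to g y
      homogeneous : ∀ (m : ℕ) x → to g (m · x) ≡ m · to g x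

  translations : Pred (V ↔ V) ℓ
  translations g = ∃ λ c → ∀ x → to g x ≡ x + c

  ConjugateInGL : Rel (Pred (V ↔ V) ℓ) ℓ
  ConjugateInGL H H′ = ∃ λ g → g ∈ GL × conjugate (Sym V) H g ≐ H′

  record IsLinearClosure (G Ḡ : Pred (V ↔ V) ℓ) : Set (suc ℓ) where
    field
      isSubgroup : IsSubgroup (Sym V) Ḡ
      linear     : Ḡ ⊆ GL
      sameOrbits : ∀ u → orbit Ḡ u ≐ orbit G u
      largest    : ∀ (H : Pred (V ↔ V) ℓ) → IsSubgroup (Sym V) H → H ⊆ GL →
                   (∀ u → orbit H u ≐ orbit G u) → H ⊆ Ḡ

module _ {V : Set ℓ} {_+_ : Op₂ V} {0# : V} { -_ : Op₁ V}
         {V⁺ : IsGroup _≡_ _+_ 0# -_} (𝕂 : NearField V⁺) where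

  open NearField 𝕂

  Cyc : Pred V≢0 ℓ → Scheme V
  Cyc K = record
    { Index = V
    ; R     = λ a x y → ∃ λ k → k ∈ K × y + (- x) ≡ a ∘ proj₁ k
    }

  baseGroup : Pred V≢0 ℓ → Pred (V ↔ V) ℓ
  baseGroup K g = ∃ λ b → b ∈ K × (∀ x → to g x ≡ x ∘ proj₁ b)

{-# OPTIONS --safe #-}
-- Let W be the E-class of 0, a subgroup of V invariant under K.  For k ≠ 1 in K
-- the map x ↦ - x + x ∘ k is an injection of V into itself preserving W, so by
-- finiteness - x + x ∘ k ∈ W forces x ∈ W: K acts semiregularly on the cosets
-- outside W.  Suppose h fixes 0 and every difference h y - h x lies in
-- (y - x) ∘ K, and write h y = y ∘ k y.  Comparing x ∉ W with 0 ≠ w ∈ W modulo W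
-- shows k x = k w, hence k is constant and h is a multiplication by an element
-- of K.  This rigidity gives Aut(C) and the linear closure.  An isomorphism
-- fixing 0 conjugates affine maps to affine maps, and translations to
-- translations because an affine map with multiplier ≠ 1 has a fixed point; hence
-- it is additive.
--
-- Neither W nor K is decidable; the arguments by contradiction are confined to
-- equations in V, where equality is decidable because V is finite.
module Submission where

open import Defs
open import Algebra.Bundles using (Group)
open import Algebra.Core using (Op₁; Op₂)
open import Algebra.Structures using (IsGroup)
import Algebra.Properties.Group as GroupProperties
open import Data.Fin.Base using (toℕ)
import Data.Fin.Properties as Fin
open import Data.Nat.Base as ℕ using (ℕ; zero; suc)
import Data.Nat.Properties as ℕ
open import Data.Nat.GeneralisedArithmetic using (fold)
open import Data.Product.Base using (∃; _×_; _,_; proj₁; proj₂)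
open import Effect.Monad using (RawMonad)
open import Function.Base using (_∘_)
open import Function.Bundles using (Injection; _⇔_; mk⇔; _↔_; Inverse; mk↔ₛ′)
open import Function.Construct.Symmetry using (↔-sym)
open import Function.Definitions using (Injective)
open import Function.Properties.Inverse using (↔⇒↣)
open import Level using (Level)
import Relation.Binary.Core as Binary
open import Relation.Binary.Definitions using (DecidableEquality)
open import Relation.Binary.PropositionalEquality
  using (_≡_; _≢_; refl; sym; trans; cong; cong₂; subst; subst₂; module ≡-Reasoning)
open import Relation.Binary.Structures using (IsEquivalence)
open import Relation.Nullary.Decidable using
  (Dec; yes; no; decidable-stable; ¬¬-excluded-middle)
open import Relation.Nullary.Negation using (¬_; ¬¬-map; ¬¬-Monad)
open import Relation.Unary using (Pred; _∈_; _⊆_; _≐_)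

private
  variable
    ℓ ℓ′ : Level

↔-injective : {A : Set ℓ} {B : Set ℓ′} (f : A ↔ B) → Injective _≡_ _≡_ (Inverse.to f)
↔-injective f = Injection.injective (↔⇒↣ f)

-- Finite sets: decidable equality, double negation, iteration of injections.

module FiniteProperties {V : Set ℓ} (fin : Finite V) where

  open Inverse (proj₂ fin) using (to; from; strictlyInverseʳ)

  infix 4 _≟_

  _≟_ : DecidableEquality V
  _≟_ = Fin.inj⇒≟ (↔⇒↣ (proj₂ fin))

  ≡-stable : {x y : V} → ¬ ¬ x ≡ y → x ≡ y
  ≡-stable {x} {y} = decidable-stable (x ≟ y)

  -- Double negation is an applicative functor, so it commutes with a product over `Fin n`; the
  -- bijection with `Fin n` carries this over to `V`.
  ¬¬-shift : {P : Pred V ℓ} → (∀ x → ¬ ¬ P x) → ¬ ¬ (∀ x → P x)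
  ¬¬-shift {P} p = ¬¬-map
    (λ q x → subst P (strictlyInverseʳ x) (q (to x)))
    (Fin.sequence (RawMonad.rawApplicative ¬¬-Monad) (p ∘ from))

  module _ {f : V → V} (f-injective : Injective _≡_ _≡_ f) where

    private
      cancel : ∀ {x} i m → fold x f (i ℕ.+ m) ≡ fold x f i → fold x f m ≡ x
      cancel zero    m eq = eq
      cancel (suc i) m eq = cancel i m (f-injective eq)

    -- By pigeonhole two of the iterates of `x` with exponents `i < j` coincide, and injectivity
    -- strips off the first `i` applications. As `j` is `suc i + m`, the period is `suc m`, hence
    -- positive.
    periodic : ∀ x → ∃ λ m → f (fold x f m) ≡ x
    periodic x with Fin.pigeonhole (ℕ.n<1+n _) (λ i → to (fold x f (toℕ i)))
    ... | i , j , i<j , eq with ℕ.m≤n⇒∃[o]m+o≡n i<j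
    ...   | m , i+m≡j = m , cancel (toℕ i) (suc m)
      (trans (cong (fold x f) (trans (ℕ.+-suc (toℕ i) m) i+m≡j))
        (sym (↔-injective (proj₂ fin) eq)))

    -- The cycle of `x` under `f` leads from `f x` back to `x`, and `closed` carries `P` along it.
    injective⇒reflects : ∀ {p} {P : Pred V p} →
                         (∀ {x} → P x → P (f x)) → ∀ {x} → P (f x) → P x
    injective⇒reflects {P = P} closed {x} Pfx with periodic x
    ... | m , eq = subst P eq (iterate m)
      where
      iterate : ∀ m → P (f (fold x f m))
      iterate zero    = Pfx
      iterate (suc m) = closed (iterate m)

-- Every point of `S` is compared with one base point `v` outside `W`: directly when it lies in `W`,
-- and by way of `u` in `W` otherwise. Stability of the final equation pays for the case
-- distinctions on `W` and for the merely non-absent `u` and `v`.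
constant : ∀ {s w} {V A : Set ℓ} {S : Pred V s} {W : Pred V w} {k : V → A} →
           (∀ {x y : A} → ¬ ¬ x ≡ y → x ≡ y) →
           ¬ ¬ (∃ λ x → S x × W x) → ¬ ¬ (∃ λ x → S x × ¬ W x) →
           (∀ {x y} → S x → W x → S y → ¬ W y → k x ≡ k y) →
           ∀ {x y} → S x → S y → k x ≡ k y
constant {S = S} {W} {k} stable ∃W ∃¬W agree {x} {y} Sx Sy = stable λ k≢ →
  ∃W λ (u , Su , Wu) → ∃¬W λ (v , Sv , ¬Wv) →
  ¬¬-excluded-middle λ Wx? → ¬¬-excluded-middle λ Wy? →
  k≢ (trans (toBase Su Wu Sv ¬Wv Sx Wx?) (sym (toBase Su Wu Sv ¬Wv Sy Wy?)))
  where
  toBase : ∀ {u v z} → S u → W u → S v → ¬ W v → S z → Dec (W z) → k z ≡ k v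
  toBase Su Wu Sv ¬Wv Sz (yes Wz) = agree Sz Wz Sv ¬Wv
  toBase Su Wu Sv ¬Wv Sz (no ¬Wz) = trans (sym (agree Su Wu Sz ¬Wz)) (agree Su Wu Sv ¬Wv)

-- Images of relations under bijections.

module _ {V V′ : Set ℓ} (f : V ↔ V′) {S : Binary.Rel V ℓ} {T : Binary.Rel V′ ℓ} where

  open Inverse f

  -- This and the next two lemmas trade the existential definition of `image` for preservation and
  -- reflection of the relation.
  image⇔⁺ : (∀ {u v} → S u v → T (to u) (to v)) →
            (∀ {u v} → T (to u) (to v) → S u v) → image f S Binary.⇔ T
  image⇔⁺ pres refl⁻ =
      (λ { (_ , _ , s , refl , refl) → pres s })
    , λ {x} {y} t → from x , from y
        , refl⁻ (subst₂ T (sym (strictlyInverseˡ x)) (sym (strictlyInverseˡ y)) t)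
        , strictlyInverseˡ x , strictlyInverseˡ y

  image⇔-preserves : image f S Binary.⇔ T → ∀ {u v} → S u v → T (to u) (to v)
  image⇔-preserves p s = proj₁ p (_ , _ , s , refl , refl)

  image⇔-reflects : image f S Binary.⇔ T → ∀ {u v} → T (to u) (to v) → S u v
  image⇔-reflects p t with proj₂ p t
  ... | _ , _ , s , eq₁ , eq₂ = subst₂ S (↔-injective f eq₁) (↔-injective f eq₂) s

Isomorphic-sym : {V V′ : Set ℓ} {𝒞 : Scheme V} {𝒞′ : Scheme V′} →
                 Isomorphic 𝒞 𝒞′ → Isomorphic 𝒞′ 𝒞
Isomorphic-sym {𝒞 = 𝒞} {𝒞′} (f , p , q) =
  ↔-sym f , (λ j → proj₁ (q j) , inv (proj₂ (q j))) , (λ i → proj₁ (p i) , inv (proj₂ (p i)))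
  where
  open Inverse f
  inv : ∀ {S T} → image f S Binary.⇔ T → image (↔-sym f) T Binary.⇔ S
  inv {S} {T} e = image⇔⁺ (↔-sym f)
    (λ {x} {y} t → image⇔-reflects f e
      (subst₂ T (sym (strictlyInverseˡ x)) (sym (strictlyInverseˡ y)) t))
    (λ {x} {y} s → subst₂ T (strictlyInverseˡ x) (strictlyInverseˡ y)
      (image⇔-preserves f e s))

image⇔-∙ : {V : Set ℓ} {f g : V ↔ V} {S T U : Binary.Rel V ℓ} →
           image f S Binary.⇔ T → image g T Binary.⇔ U →
           image (Group._∙_ (Sym V) f g) S Binary.⇔ U
image⇔-∙ {V = V} {f} {g} p q = image⇔⁺ (Group._∙_ (Sym V) f g)
  (image⇔-preserves g q ∘ image⇔-preserves f p)
  (image⇔-reflects f p ∘ image⇔-reflects g q)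

-- The additive group and additive maps.

module AdditiveProperties {V : Set ℓ} {_+_ : Op₂ V} {0# : V} { -_ : Op₁ V}
                          (V⁺ : IsGroup _≡_ _+_ 0# -_) where

  V⁺-group : Group ℓ ℓ
  V⁺-group = record { isGroup = V⁺ }

  open Group V⁺-group public
    using (assoc; identityˡ; identityʳ; inverseˡ; inverseʳ) renaming (_//_ to infixl 6 _-_)
  open GroupProperties V⁺-group public
  open ≡-Reasoning

  x-0≡x : ∀ x → x - 0# ≡ x
  x-0≡x x = trans (cong (x +_) ε⁻¹≈ε) (identityʳ x)

  translate-sub : ∀ y x c → (y + c) - (x + c) ≡ y - x
  translate-sub y x c = begin
    (y + c) - (x + c)        ≡⟨ cong ((y + c) +_) (⁻¹-anti-homo-∙ x c) ⟩
    (y + c) + ((- c) + (- x)) ≡⟨ assoc (y + c) (- c) (- x) ⟨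
    ((y + c) - c) - x         ≡⟨ cong (_- x) (//-rightDividesʳ c y) ⟩
    y - x                     ∎

  -- The order of summands is kept throughout, as the group is not assumed commutative. This passes
  -- from right differences, which define the scheme, to left differences, which have the shape of
  -- `displacement`.
  difference-swap : ∀ {p q r s} → p - q ≡ r - s → (- r) + p ≡ (- s) + q
  difference-swap {p} {q} {r} {s} eq = begin
    (- r) + p              ≡⟨ cong ((- r) +_) (//-rightDividesˡ q p) ⟨
    (- r) + ((p - q) + q)  ≡⟨ cong (λ z → (- r) + (z + q)) eq ⟩
    (- r) + ((r - s) + q)  ≡⟨ cong ((- r) +_) (assoc r (- s) q) ⟩
    (- r) + (r + ((- s) + q)) ≡⟨ \\-leftDividesʳ r _ ⟩
    (- s) + q              ∎

  translation : V → V ↔ V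
  translation c = mk↔ₛ′ (_+ c) (_- c) (//-rightDividesˡ c) (//-rightDividesʳ c)

  Additive : (V → V) → Set ℓ
  Additive h = ∀ x y → h (x + y) ≡ h x + h y

  module _ {h : V → V} (additive : Additive h) where

    additive-0 : h 0# ≡ 0#
    additive-0 = identityˡ-unique _ _ (trans (sym (additive 0# 0#)) (cong h (identityˡ 0#)))

    additive-neg : ∀ x → h (- x) ≡ - h x
    additive-neg x = inverseˡ-unique _ _
      (trans (sym (additive (- x) x)) (trans (cong h (inverseˡ x)) additive-0))

    additive-sub : ∀ y x → h (y - x) ≡ h y - h x
    additive-sub y x = trans (additive y (- x)) (cong (h y +_) (additive-neg x))

    additive-× : ∀ m x → h (_·_ V⁺ m x) ≡ _·_ V⁺ m (h x)
    additive-× zero    x = additive-0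
    additive-× (suc m) x = trans (additive x _) (cong (h x +_) (additive-× m x))

  -- Scalars act as repeated sums, so additivity brings homogeneity with it.
  additive⇒GL : {g : V ↔ V} → Additive (Inverse.to g) → GL V⁺ g
  additive⇒GL additive = record
    { additive = additive ; homogeneous = additive-× additive }

-- Right multiplications in a finite near-field.

module NearFieldProperties {V : Set ℓ} {_+_ : Op₂ V} {0# : V} { -_ : Op₁ V}
                           {V⁺ : IsGroup _≡_ _+_ 0# -_} (fin : Finite V)
                           (𝕂 : NearField V⁺) where

  open NearField 𝕂 renaming (_∘_ to _∙_)
  open FiniteProperties fin
  open AdditiveProperties V⁺
  open ≡-Reasoning
  private
    module × = Group ×-group
    module ×ₚ = GroupProperties ×-group

  infixl 25 _⊙_

  -- The right action of the multiplicative group on all of `V`, zero included.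
  _⊙_ : V → V≢0 → V
  x ⊙ b = x ∙ proj₁ b

  ⊙-additive : ∀ b → Additive (_⊙ b)
  ⊙-additive b x y = distribʳ x y (proj₁ b)

  0-⊙ : ∀ b → 0# ⊙ b ≡ 0#
  0-⊙ b = additive-0 (⊙-additive b)

  ⊙-sub : ∀ y x b → (y - x) ⊙ b ≡ y ⊙ b - x ⊙ b
  ⊙-sub y x b = additive-sub (⊙-additive b) y x

  -- The group law covers nonzero `x` only. At zero both sides vanish, because right multiplication
  -- is additive.
  ⊙-assoc : ∀ x b c → x ⊙ b ⊙ c ≡ x ⊙ (b ∘× c)
  ⊙-assoc x b c with x ≟ 0#
  ... | no x≢0   = ×.assoc (x , x≢0) b c
  ... | yes refl = begin
    0# ⊙ b ⊙ c    ≡⟨ cong (_⊙ c) (0-⊙ b) ⟩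
    0# ⊙ c        ≡⟨ 0-⊙ c ⟩
    0#            ≡⟨ 0-⊙ (b ∘× c) ⟨
    0# ⊙ (b ∘× c) ∎

  ⊙-identity : ∀ x → x ⊙ 1× ≡ x
  ⊙-identity x with x ≟ 0#
  ... | no x≢0   = ×.identityʳ (x , x≢0)
  ... | yes refl = 0-⊙ 1×

  ⊙-inverseʳ : ∀ x b → x ⊙ b ⊙ (b ⁻¹×) ≡ x
  ⊙-inverseʳ x b = trans (⊙-assoc x b (b ⁻¹×)) (trans (cong (x ∙_) (×.inverseʳ b)) (⊙-identity x))

  ⊙-inverseˡ : ∀ x b → x ⊙ (b ⁻¹×) ⊙ b ≡ x
  ⊙-inverseˡ x b = trans (⊙-assoc x (b ⁻¹×) b) (trans (cong (x ∙_) (×.inverseˡ b)) (⊙-identity x))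

  ⊙-cancelˡ : ∀ {x b c} → x ≢ 0# → x ⊙ b ≡ x ⊙ c → proj₁ b ≡ proj₁ c
  ⊙-cancelˡ {x} {b} {c} x≢0 = ×ₚ.∙-cancelˡ (x , x≢0) b c

  multiplication : V≢0 → V ↔ V
  multiplication b = mk↔ₛ′ (_⊙ b) (_⊙ (b ⁻¹×)) (λ x → ⊙-inverseˡ x b) (λ x → ⊙-inverseʳ x b)

  displacement : V≢0 → V → V
  displacement k x = (- x) + x ⊙ k

  -- Equal displacements of `x` and `y` make `x - y` a fixed point of `k`; if `x - y` is nonzero,
  -- cancelling it gives `k` equal to 1.
  displacement-injective : ∀ {k} → proj₁ k ≢ proj₁ 1× → Injective _≡_ _≡_ (displacement k)
  displacement-injective {k} k≢1 {x} {y} eq = ≡-stable λ x≢y →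
    k≢1 (⊙-cancelˡ {b = k} {c = 1×} (λ x-y≡0 → x≢y (x∙y⁻¹≈ε⇒x≈y x y x-y≡0)) (begin
      (x - y) ⊙ k   ≡⟨ ⊙-sub x y k ⟩
      x ⊙ k - y ⊙ k ≡⟨ cong (_- y ⊙ k) (\\-leftDividesˡ x (x ⊙ k)) ⟨
      (x + ((- x) + x ⊙ k)) - y ⊙ k ≡⟨ cong (λ z → (x + z) - y ⊙ k) eq ⟩
      (x + ((- y) + y ⊙ k)) - y ⊙ k ≡⟨ cong (_- y ⊙ k) (assoc x (- y) (y ⊙ k)) ⟨
      ((x - y) + y ⊙ k) - y ⊙ k     ≡⟨ //-rightDividesʳ (y ⊙ k) (x - y) ⟩
      x - y         ≡⟨ ⊙-identity (x - y) ⟨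
      (x - y) ⊙ 1×  ∎))

  -- The equation says that `x` has displacement `- c`. An injection of a finite set is onto, and
  -- the preimage of `- c` is the last point of its cycle before the return.
  fixedPoint : ∀ {k} → proj₁ k ≢ proj₁ 1× → ∀ c → ∃ λ x → x ⊙ k + c ≡ x
  fixedPoint {k} k≢1 c with periodic (displacement-injective {k} k≢1) (- c)
  ... | m , eq = x , (begin
      x ⊙ k + c                   ≡⟨ cong (_+ c) (\\-leftDividesˡ x (x ⊙ k)) ⟨
      (x + displacement k x) + c  ≡⟨ cong (λ z → (x + z) + c) eq ⟩
      (x - c) + c                 ≡⟨ //-rightDividesˡ c x ⟩
      x                           ∎)
    where x = fold (- c) (displacement k) m

  -- Affine maps with multiplier in `K` and the relations of the scheme.

  module _ {K : Pred V≢0 ℓ} (K-subgroup : IsSubgroup ×-group K) where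

    open IsSubgroup K-subgroup
    open Inverse using (to; from; strictlyInverseˡ; strictlyInverseʳ)

    -- Multiplications fix 0, so the constant term can only be `h 0#`.
    Affine : (V → V) → Set ℓ
    Affine h = ∃ λ b → b ∈ K × (∀ x → h x ≡ x ⊙ b + h 0#)

    -- Here the multiplier may depend on the pair. Automorphisms and orbit-preserving linear maps
    -- both supply this weak form, and `rigidity` upgrades it to `Affine`.
    Respecting : (V → V) → Set ℓ
    Respecting h = ∀ x y → ∃ λ k → k ∈ K × h y - h x ≡ (y - x) ⊙ k

    open Scheme (Cyc 𝕂 K)

    R-difference : ∀ x y → R (y - x) x y
    R-difference x y = 1× , ε-closed , sym (⊙-identity (y - x))

    translation-affine : ∀ c → Affine (_+ c)
    translation-affine c = 1× , ε-closed , λ x →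
      cong₂ _+_ (sym (⊙-identity x)) (sym (identityˡ c))

    baseGroup⇒additive : ∀ {g} → g ∈ baseGroup 𝕂 K → Additive (to g)
    baseGroup⇒additive {g} (b , _ , eq) x y = begin
      to g (x + y)      ≡⟨ eq (x + y) ⟩
      (x + y) ⊙ b       ≡⟨ ⊙-additive b x y ⟩
      x ⊙ b + y ⊙ b     ≡⟨ cong₂ _+_ (eq x) (eq y) ⟨
      to g x + to g y   ∎

    baseGroup⇒affine : ∀ {g} → g ∈ baseGroup 𝕂 K → Affine (to g)
    baseGroup⇒affine {g} g∈G@(b , b∈K , eq) = b , b∈K , λ x → begin
      to g x            ≡⟨ eq x ⟩
      x ⊙ b             ≡⟨ identityʳ (x ⊙ b) ⟨
      x ⊙ b + 0#        ≡⟨ cong (x ⊙ b +_) (additive-0 (baseGroup⇒additive {g} g∈G)) ⟨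
      x ⊙ b + to g 0#   ∎

    affine⇒baseGroup : ∀ {g} → Affine (to g) → to g 0# ≡ 0# → g ∈ baseGroup 𝕂 K
    affine⇒baseGroup {g} (b , b∈K , eq) g0≡0 = b , b∈K , λ x →
      trans (eq x) (trans (cong (x ⊙ b +_) g0≡0) (identityʳ (x ⊙ b)))

    affine⇒setProduct : ∀ {g} → Affine (to g) →
                        g ∈ setProduct (Sym V) (translations V⁺) (baseGroup 𝕂 K)
    affine⇒setProduct {g} (b , b∈K , eq) =
      -- Products act from left to right: the translation comes first and its vector is then
      -- multiplied by `b`, so `c` is `to g 0#` times the inverse of `b`.
      translation c , multiplication b , (c , λ _ → refl) , (b , b∈K , λ _ → refl) , λ x → begin
        to g x               ≡⟨ eq x ⟩
        x ⊙ b + to g 0#      ≡⟨ cong (x ⊙ b +_) (⊙-inverseˡ (to g 0#) b) ⟨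
        x ⊙ b + c ⊙ b        ≡⟨ ⊙-additive b x c ⟨
        (x + c) ⊙ b          ∎
      where c = to g 0# ⊙ (b ⁻¹×)

    setProduct⇒affine : ∀ {g} → g ∈ setProduct (Sym V) (translations V⁺) (baseGroup 𝕂 K) →
                        Affine (to g)
    setProduct⇒affine {g} (t , m , (c , t-eq) , (b , b∈K , m-eq) , eq) = b , b∈K , λ x → begin
        to g x               ≡⟨ value x ⟩
        x ⊙ b + c ⊙ b        ≡⟨ cong (x ⊙ b +_) (identityˡ (c ⊙ b)) ⟨
        x ⊙ b + (0# + c ⊙ b) ≡⟨ cong (λ z → x ⊙ b + (z + c ⊙ b)) (0-⊙ b) ⟨
        x ⊙ b + (0# ⊙ b + c ⊙ b) ≡⟨ cong (x ⊙ b +_) (value 0#) ⟨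
        x ⊙ b + to g 0#      ∎
      where
      value : ∀ x → to g x ≡ x ⊙ b + c ⊙ b
      value x = begin
        to g x               ≡⟨ eq x ⟩
        to m (to t x)        ≡⟨ m-eq (to t x) ⟩
        to t x ⊙ b           ≡⟨ cong (_⊙ b) (t-eq x) ⟩
        (x + c) ⊙ b          ≡⟨ ⊙-additive b x c ⟩
        x ⊙ b + c ⊙ b        ∎

    affine-difference : ∀ {h} ((b , _) : Affine h) → ∀ x y → h y - h x ≡ (y - x) ⊙ b
    affine-difference {h} (b , _ , eq) x y = begin
      h y - h x                         ≡⟨ cong₂ _-_ (eq y) (eq x) ⟩
      (y ⊙ b + h 0#) - (x ⊙ b + h 0#)   ≡⟨ translate-sub _ _ _ ⟩
      y ⊙ b - x ⊙ b                     ≡⟨ ⊙-sub y x b ⟨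
      (y - x) ⊙ b                       ∎

    affine-preserves : ∀ {h} → Affine h → ∀ {i x y} → R i x y → R i (h x) (h y)
    affine-preserves {h} A@(b , b∈K , _) {i} {x} {y} (k , k∈K , eq) =
      k ∘× b , ∙-closed k∈K b∈K , (begin
        h y - h x      ≡⟨ affine-difference A x y ⟩
        (y - x) ⊙ b    ≡⟨ cong (_⊙ b) eq ⟩
        i ⊙ k ⊙ b      ≡⟨ ⊙-assoc i k b ⟩
        i ⊙ (k ∘× b)   ∎)

    affine-reflects : ∀ {h} → Affine h → ∀ {i x y} → R i (h x) (h y) → R i x y
    affine-reflects {h} A@(b , b∈K , _) {i} {x} {y} (k , k∈K , eq) =
      k ∘× (b ⁻¹×) , ∙-closed k∈K (⁻¹-closed b∈K) , (begin
        y - x                    ≡⟨ ⊙-inverseʳ (y - x) b ⟨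
        (y - x) ⊙ b ⊙ (b ⁻¹×)    ≡⟨ cong (_⊙ (b ⁻¹×)) (affine-difference A x y) ⟨
        (h y - h x) ⊙ (b ⁻¹×)    ≡⟨ cong (_⊙ (b ⁻¹×)) eq ⟩
        i ⊙ k ⊙ (b ⁻¹×)          ≡⟨ ⊙-assoc i k (b ⁻¹×) ⟩
        i ⊙ (k ∘× (b ⁻¹×))       ∎)

    affine⇒Aut : ∀ {g} → Affine (to g) → g ∈ Aut (Cyc 𝕂 K)
    affine⇒Aut {g} A i = image⇔⁺ g (affine-preserves A) (affine-reflects A)

    Aut⇒respecting : ∀ {g} → g ∈ Aut (Cyc 𝕂 K) → Respecting (to g)
    Aut⇒respecting {g} g∈Aut x y = image⇔-preserves g (g∈Aut (y - x)) (R-difference x y)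

    baseGroup-isSubgroup : IsSubgroup (Sym V) (baseGroup 𝕂 K)
    baseGroup-isSubgroup = record
      { resp      = λ { p (b , b∈K , eq) → b , b∈K , λ x → trans (sym (p x)) (eq x) }
      ; ε-closed  = 1× , ε-closed , λ x → sym (⊙-identity x)
      ; ∙-closed  = λ { {f} {g} (b , b∈K , eq) (c , c∈K , eq′) → b ∘× c , ∙-closed b∈K c∈K ,
                        λ x → trans (eq′ (to f x)) (trans (cong (_⊙ c) (eq x)) (⊙-assoc x b c)) }
      ; ⁻¹-closed = λ { {f} (b , b∈K , eq) → b ⁻¹× , ⁻¹-closed b∈K , λ x → begin
          from f x                     ≡⟨ ⊙-inverseʳ (from f x) b ⟨
          from f x ⊙ b ⊙ (b ⁻¹×)       ≡⟨ cong (_⊙ (b ⁻¹×)) (eq (from f x)) ⟨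
          to f (from f x) ⊙ (b ⁻¹×)    ≡⟨ cong (_⊙ (b ⁻¹×)) (strictlyInverseˡ f x) ⟩
          x ⊙ (b ⁻¹×)                  ∎ }
      }

    -- Rigidity of imprimitive schemes.

    module Rigidity (imprimitive : Imprimitive (Cyc 𝕂 K)) where

      open Imprimitive imprimitive
      private module E = IsEquivalence isEquivalence

      W : Pred V ℓ
      W x = E 0# x

      -- `E` is a union of relations of the scheme, and affine maps preserve each of them.
      E-affine : ∀ {h} → Affine h → ∀ {x y} → E x y → E (h x) (h y)
      E-affine A e with proj₁ E-union e
      ... | i , i∈I , r = proj₂ E-union (i , i∈I , affine-preserves A r)

      E-translate : ∀ c {x y} → E x y → E (x + c) (y + c)
      E-translate c = E-affine (translation-affine c)

      E⇒W : ∀ {x y} → E x y → W (y - x)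
      E⇒W {x} {y} e = subst (λ z → E z (y - x)) (inverseʳ x) (E-translate (- x) e)

      W⇒E : ∀ {x y} → W (y - x) → E x y
      W⇒E {x} {y} w = subst₂ E (identityˡ x) (//-rightDividesˡ x y) (E-translate x w)

      W-neg : ∀ {x} → W x → W (- x)
      W-neg {x} w = subst W (identityˡ (- x)) (E⇒W (E.sym w))

      W-+ : ∀ {x y} → W x → W y → W (x + y)
      W-+ {x} {y} v w = E.trans w (subst (λ z → E z (x + y)) (identityˡ y) (E-translate y v))

      W-⊙ : ∀ {x k} → k ∈ K → W x → W (x ⊙ k)
      W-⊙ {x} {k} k∈K w = subst (λ z → E z (x ⊙ k)) (0-⊙ k)
        (E-affine (baseGroup⇒affine {multiplication k} (k , k∈K , λ _ → refl)) w)

      -- The only coset `x + W` that can contain `x ⊙ k` as well is `W` itself.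
      W-displacement : ∀ {k x} → k ∈ K → proj₁ k ≢ proj₁ 1× → W (displacement k x) → W x
      W-displacement {k} k∈K k≢1 = injective⇒reflects
        {f = displacement k} (displacement-injective {k} k≢1) {P = W} (λ {x} w → W-+ (W-neg w) (W-⊙ k∈K w))

      ¬¬nonzero-in-W : ¬ ¬ (∃ λ x → x ≢ 0# × W x)
      ¬¬nonzero-in-W none = E≢diagonal
        ( (λ {x} {y} e → sym (x∙y⁻¹≈ε⇒x≈y y x (≡-stable λ y-x≢0 → none (y - x , y-x≢0 , E⇒W e))))
        , λ { refl → E.refl } )

      -- If no such point exists, each single `W x` holds up to double negation. `¬¬-shift` moves
      -- the double negation outside the quantifier, where `E≢V²` refutes it.
      ¬¬outside-W : ¬ ¬ (∃ λ x → x ≢ 0# × ¬ W x)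
      ¬¬outside-W none = ¬¬-shift
        (λ x ¬Wx → none (x , (λ { refl → ¬Wx E.refl }) , ¬Wx))
        (λ all → E≢V² λ x y → W⇒E (all (y - x)))

      -- Modulo W the hypothesis reads x ⊙ a ≡ x ⊙ c.
      multipliers-agree : ∀ {x w a b c} → a ∈ K → c ∈ K → b ∈ K → ¬ W x → W w → w ≢ 0# →
                          x ⊙ a - w ⊙ b ≡ (x - w) ⊙ c → proj₁ a ≡ proj₁ b
      multipliers-agree {x} {w} {a} {b} {c} a∈K c∈K b∈K ¬Wx Ww w≢0 eq = trans a≡c (sym b≡c)
        where
        swapped : (- (x ⊙ c)) + x ⊙ a ≡ (- (w ⊙ c)) + w ⊙ b
        swapped = difference-swap (trans eq (⊙-sub x w c))

        c⁻¹a : V≢0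
        c⁻¹a = (c ⁻¹×) ∘× a

        x⊙c⊙c⁻¹a : x ⊙ c ⊙ c⁻¹a ≡ x ⊙ a
        x⊙c⊙c⁻¹a = trans (sym (⊙-assoc (x ⊙ c) (c ⁻¹×) a)) (cong (_⊙ a) (⊙-inverseʳ x c))

        -- The left side of `swapped` is the displacement of `x ⊙ c` under `c⁻¹a`, and the right
        -- side lies in `W`. If `c⁻¹a` were not 1, then `x ⊙ c`, and with it `x`, would lie in `W`.
        a≡c : proj₁ a ≡ proj₁ c
        a≡c = ≡-stable λ a≢c → ¬Wx (subst W (⊙-inverseʳ x c) (W-⊙ (⁻¹-closed c∈K)
          (W-displacement (∙-closed (⁻¹-closed c∈K) a∈K)
            (λ c⁻¹a≡1 → a≢c (trans (×ₚ.inverseʳ-unique (c ⁻¹×) a c⁻¹a≡1)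
                                   (×ₚ.⁻¹-involutive c)))
            (subst W (sym (trans (cong ((- (x ⊙ c)) +_) x⊙c⊙c⁻¹a) swapped))
              (W-+ (W-neg (W-⊙ c∈K Ww)) (W-⊙ b∈K Ww))))))

        -- Now the left side of `swapped` is 0, so `w ⊙ b` equals `w ⊙ c`, and the nonzero `w`
        -- cancels.
        b≡c : proj₁ b ≡ proj₁ c
        b≡c = ⊙-cancelˡ {b = b} {c} w≢0 (∙-cancelˡ (- (w ⊙ c)) (w ⊙ b) (w ⊙ c) (begin
          (- (w ⊙ c)) + w ⊙ b ≡⟨ swapped ⟨
          (- (x ⊙ c)) + x ⊙ a ≡⟨ cong (λ z → (- (x ⊙ c)) + (x ∙ z)) a≡c ⟩
          (- (x ⊙ c)) + x ⊙ c ≡⟨ inverseˡ (x ⊙ c) ⟩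
          0#                  ≡⟨ inverseˡ (w ⊙ c) ⟨
          (- (w ⊙ c)) + w ⊙ c ∎))

      rigidity : ∀ {h} → Respecting h → Affine h
      -- The common multiplier is read off at 1, a nonzero point that is always at hand.
      rigidity {h} respecting = k (proj₁ 1×) , k∈K (proj₁ 1×) , λ x → begin
          h x                      ≡⟨ //-rightDividesˡ (h 0#) (h x) ⟨
          (h x - h 0#) + h 0#      ≡⟨ cong (_+ h 0#) (h₀ x) ⟩
          x ⊙ k x + h 0#           ≡⟨ cong (_+ h 0#) (k-constant x) ⟩
          x ⊙ k (proj₁ 1×) + h 0#  ∎
        where
        k : V → V≢0
        k x = proj₁ (respecting 0# x)

        k∈K : ∀ x → k x ∈ K
        k∈K x = proj₁ (proj₂ (respecting 0# x))

        h₀ : ∀ x → h x - h 0# ≡ x ⊙ k x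
        h₀ x = trans (proj₂ (proj₂ (respecting 0# x))) (cong (_⊙ k x) (x-0≡x x))

        agree : ∀ {w x} → w ≢ 0# → W w → x ≢ 0# → ¬ W x → proj₁ (k w) ≡ proj₁ (k x)
        agree {w} {x} w≢0 Ww _ ¬Wx with respecting w x
        ... | c , c∈K , eq = sym (multipliers-agree (k∈K x) c∈K (k∈K w) ¬Wx Ww w≢0 (begin
          x ⊙ k x - w ⊙ k w           ≡⟨ cong₂ _-_ (h₀ x) (h₀ w) ⟨
          (h x - h 0#) - (h w - h 0#) ≡⟨ translate-sub (h x) (h w) (- h 0#) ⟩
          h x - h w                   ≡⟨ eq ⟩
          (x - w) ⊙ c                 ∎))

        -- Products are compared rather than multipliers, since `k 0#` is arbitrary.
        k-constant : ∀ x → x ⊙ k x ≡ x ⊙ k (proj₁ 1×)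
        k-constant x with x ≟ 0#
        ... | yes refl = trans (0-⊙ (k 0#)) (sym (0-⊙ (k (proj₁ 1×))))
        ... | no x≢0   = cong (x ∙_)
          (constant {W = W} {proj₁ ∘ k} ≡-stable ¬¬nonzero-in-W ¬¬outside-W agree
            x≢0 (proj₂ 1×))

      Aut≐affine : Aut (Cyc 𝕂 K) ≐ setProduct (Sym V) (translations V⁺) (baseGroup 𝕂 K)
      Aut≐affine =
          (λ {g} g∈Aut → affine⇒setProduct {g} (rigidity (Aut⇒respecting {g} g∈Aut)))
        , (λ {g} g∈TG → affine⇒Aut {g} (setProduct⇒affine {g} g∈TG))

      -- An additive map `h` with orbits inside those of the base group sends `y - x` into its
      -- `K`-orbit, and additivity turns this into `Respecting`. By rigidity `h` is affine, and it
      -- fixes 0.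
      baseGroup-linearClosed : IsLinearClosure V⁺ (baseGroup 𝕂 K) (baseGroup 𝕂 K)
      baseGroup-linearClosed = record
        { isSubgroup = baseGroup-isSubgroup
        ; linear     = λ {g} g∈G → additive⇒GL (baseGroup⇒additive {g} g∈G)
        ; sameOrbits = λ _ → (λ o → o) , (λ o → o)
        ; largest    = λ H _ H⊆GL orbits {h} h∈H →
            let additive = GL.additive (H⊆GL h∈H) in
            affine⇒baseGroup {h} (rigidity (respecting orbits h∈H additive)) (additive-0 additive)
        }
        where
        respecting : ∀ {H : Pred (V ↔ V) ℓ} {h} →
                     (∀ u → orbit H u ≐ orbit (baseGroup 𝕂 K) u) →
                     h ∈ H → Additive (to h) → Respecting (to h)
        respecting {h = h} orbits h∈H additive x y
          with proj₁ (orbits (y - x)) (h , h∈H , refl)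
        ... | g , (b , b∈K , g-eq) , gu≡hu = b , b∈K , (begin
          to h y - to h x ≡⟨ additive-sub additive y x ⟨
          to h (y - x)    ≡⟨ gu≡hu ⟨
          to g (y - x)    ≡⟨ g-eq (y - x) ⟩
          (y - x) ⊙ b     ∎)

-- Isomorphisms of schemes and conjugacy of base groups.

module Isomorphisms {V : Set ℓ} {_+_ : Op₂ V} {0# : V} { -_ : Op₁ V}
                    {V⁺ : IsGroup _≡_ _+_ 0# -_} (fin : Finite V) where

  open AdditiveProperties V⁺
  open FiniteProperties fin
  open Inverse using (to; from; strictlyInverseˡ; strictlyInverseʳ)
  open ≡-Reasoning

  module _ (𝕂 𝕂′ : NearField V⁺)
           {K : Pred (NearField.V≢0 𝕂) ℓ} (K-sub : IsSubgroup (NearField.×-group 𝕂) K)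
           {K′ : Pred (NearField.V≢0 𝕂′) ℓ} (K′-sub : IsSubgroup (NearField.×-group 𝕂′) K′)
           where

    private
      module N  = NearFieldProperties fin 𝕂
      module N′ = NearFieldProperties fin 𝕂′
      𝒞  = Cyc 𝕂 K
      𝒞′ = Cyc 𝕂′ K′
      G  = baseGroup 𝕂 K
      G′ = baseGroup 𝕂′ K′

    -- Composing with the translation by `- f 0` moves the image of 0 back to 0. It is an
    -- automorphism of `𝒞′`, so every relation keeps its image.
    normalise : Isomorphic 𝒞 𝒞′ → ∃ λ ((g , _) : Isomorphic 𝒞 𝒞′) → to g 0# ≡ 0#
    normalise (f , p , q) =
        ( Group._∙_ (Sym V) f t
        , (λ i → proj₁ (p i) , image⇔-∙ {f = f} {t} (proj₂ (p i)) (t∈Aut (proj₁ (p i))))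
        , (λ j → proj₁ (q j) , image⇔-∙ {f = f} {t} (proj₂ (q j)) (t∈Aut j)) )
      , inverseʳ (to f 0#)
      where
      t : V ↔ V
      t = translation (- to f 0#)

      t∈Aut : t ∈ Aut 𝒞′
      t∈Aut = N′.affine⇒Aut K′-sub {t} (N′.translation-affine K′-sub (- to f 0#))

    module _ (imprimitive′ : Imprimitive 𝒞′) (iso : Isomorphic 𝒞 𝒞′) where

      private
        f : V ↔ V
        f = proj₁ iso

      -- An affine map preserves every relation of `𝒞`, so its conjugate preserves every relation of
      -- `𝒞′`; rigidity of `𝒞′` applies.
      conjugate-affine : ∀ {h} → N.Affine K-sub h → N′.Affine K′-sub (to f ∘ h ∘ from f)
      conjugate-affine {h} A = N′.Rigidity.rigidity K′-sub imprimitive′ λ x y →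
        -- `i` indexes the relation of `𝒞` that `f` carries onto the one containing `(x , y)`.
        let (i , e) = proj₂ (proj₂ iso) (y + (- x)) in
        image⇔-preserves f e (N.affine-preserves K-sub A (image⇔-reflects f e
          (subst₂ (Scheme.R 𝒞′ (y + (- x)))
            (sym (strictlyInverseˡ f x)) (sym (strictlyInverseˡ f y))
            (N′.R-difference K′-sub x y))))

      module _ (f0≡0 : to (proj₁ iso) 0# ≡ 0#) where

        private
          f⁻¹0≡0 : from f 0# ≡ 0#
          f⁻¹0≡0 = trans (cong (from f) (sym f0≡0)) (strictlyInverseʳ f 0#)

        -- Elements of the base group are affine maps fixing 0, and both properties survive
        -- conjugation by a map `f` that fixes 0.
        conjugate-baseGroup : conjugate (Sym V) G f ⊆ G′
        conjugate-baseGroup {g} (h , h∈G , eq) =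
          IsSubgroup.resp (N′.baseGroup-isSubgroup K′-sub) {f⁻¹hf} {g} (λ x → sym (eq x))
            (N′.affine⇒baseGroup K′-sub {f⁻¹hf}
              (conjugate-affine (N.baseGroup⇒affine K-sub {h} h∈G))
              (begin
                to f (to h (from f 0#)) ≡⟨ cong (to f ∘ to h) f⁻¹0≡0 ⟩
                to f (to h 0#)          ≡⟨ cong (to f) (additive-0 (N.baseGroup⇒additive K-sub {h} h∈G)) ⟩
                to f 0#                 ≡⟨ f0≡0 ⟩
                0#                      ∎))
          where
          open Group (Sym V) using (_∙_; _⁻¹)
          f⁻¹hf = f ⁻¹ ∙ h ∙ f

        -- The conjugate of translation by `t` is affine with constant term `f t`. A multiplier
        -- other than 1 would give it a fixed point, and so give one to a translation by a nonzero
        -- `t`; the case of zero `t` is settled separately.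
        additive : Additive (to f)
        additive x t with t ≟ 0#
        ... | yes refl = begin
          to f (x + 0#)      ≡⟨ cong (to f) (identityʳ x) ⟩
          to f x             ≡⟨ identityʳ (to f x) ⟨
          to f x + 0#        ≡⟨ cong (to f x +_) f0≡0 ⟨
          to f x + to f 0#   ∎
        ... | no t≢0 with conjugate-affine (N.translation-affine K-sub t)
        ...   | b , _ , eq = begin
          to f (x + t)                       ≡⟨ cong (λ z → to f (z + t)) (strictlyInverseʳ f x) ⟨
          to f (from f (to f x) + t)         ≡⟨ value (to f x) ⟩
          to f x N′.⊙ b + to f t             ≡⟨ cong (λ z → (NearField._∘_ 𝕂′ (to f x) z) + to f t) b≡1 ⟩
          to f x N′.⊙ NearField.1× 𝕂′ + to f t ≡⟨ cong (_+ to f t) (N′.⊙-identity (to f x)) ⟩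
          to f x + to f t                    ∎
          where
          value : ∀ y → to f (from f y + t) ≡ y N′.⊙ b + to f t
          value y = trans (eq y) (cong (λ z → y N′.⊙ b + to f z)
            (trans (cong (_+ t) f⁻¹0≡0) (identityˡ t)))

          b≡1 : proj₁ b ≡ proj₁ (NearField.1× 𝕂′)
          b≡1 = ≡-stable λ b≢1 →
            let (y , fixed) = N′.fixedPoint {b} b≢1 (to f t) in
            t≢0 (identityʳ-unique (from f y) t (↔-injective f
              (trans (value y) (trans fixed (sym (strictlyInverseˡ f y))))))

    -- Conjugation by `g` matches the orbit of `i` under `G` with that of `g i` under `G′`, and `g`
    -- respects differences. Hence the relation of index `i` goes to the one of index `g i`.
    conjugate⇒isomorphic : ConjugateInGL V⁺ G G′ → Isomorphic 𝒞 𝒞′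
    conjugate⇒isomorphic (g , g∈GL , ⊆G′ , G′⊆) =
      g , (λ i → to g i , image-R i) , λ j → from g j ,
        subst (λ z → image g (Scheme.R 𝒞 (from g j)) Binary.⇔ Scheme.R 𝒞′ z)
          (strictlyInverseˡ g j) (image-R (from g j))
      where
      open Group (Sym V) using (_∙_; _⁻¹)

      g-sub : ∀ y x → to g (y + (- x)) ≡ to g y + (- to g x)
      g-sub = additive-sub (GL.additive g∈GL)

      image-R : ∀ i → image g (Scheme.R 𝒞 i) Binary.⇔ Scheme.R 𝒞′ (to g i)
      image-R i = image⇔⁺ g preserves reflects
        where
        preserves : ∀ {x y} → Scheme.R 𝒞 i x y → Scheme.R 𝒞′ (to g i) (to g x) (to g y)
        preserves {x} {y} (k , k∈K , eq)
          with ⊆G′ {g ⁻¹ ∙ m ∙ g} (m , (k , k∈K , λ _ → refl) , λ _ → refl)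
          where m = N.multiplication k
        ... | k′ , k′∈K′ , conj-eq = k′ , k′∈K′ , (begin
          to g y + (- to g x)               ≡⟨ g-sub y x ⟨
          to g (y + (- x))                  ≡⟨ cong (to g) eq ⟩
          to g (i N.⊙ k)                    ≡⟨ cong (λ z → to g (z N.⊙ k)) (strictlyInverseʳ g i) ⟨
          to g (from g (to g i) N.⊙ k)      ≡⟨ conj-eq (to g i) ⟩
          to g i N′.⊙ k′                    ∎)

        reflects : ∀ {x y} → Scheme.R 𝒞′ (to g i) (to g x) (to g y) → Scheme.R 𝒞 i x y
        reflects {x} {y} (k′ , k′∈K′ , eq)
          with G′⊆ {N′.multiplication k′} (k′ , k′∈K′ , λ _ → refl)
        ... | h , (k , k∈K , h-eq) , conj-eq = k , k∈K , ↔-injective g (begin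
          to g (y + (- x))                  ≡⟨ g-sub y x ⟩
          to g y + (- to g x)               ≡⟨ eq ⟩
          to g i N′.⊙ k′                    ≡⟨ conj-eq (to g i) ⟩
          to g (to h (from g (to g i)))     ≡⟨ cong (to g ∘ to h) (strictlyInverseʳ g i) ⟩
          to g (to h i)                     ≡⟨ cong (to g) (h-eq i) ⟩
          to g (i N.⊙ k)                    ∎)

  isomorphic⇒conjugate :
    (𝕂 𝕂′ : NearField V⁺)
    {K : Pred (NearField.V≢0 𝕂) ℓ} (K-sub : IsSubgroup (NearField.×-group 𝕂) K)
    {K′ : Pred (NearField.V≢0 𝕂′) ℓ} (K′-sub : IsSubgroup (NearField.×-group 𝕂′) K′) →
    Imprimitive (Cyc 𝕂 K) → Imprimitive (Cyc 𝕂′ K′) →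
    Isomorphic (Cyc 𝕂 K) (Cyc 𝕂′ K′) →
    ConjugateInGL V⁺ (baseGroup 𝕂 K) (baseGroup 𝕂′ K′)
  isomorphic⇒conjugate 𝕂 𝕂′ {K} K-sub {K′} K′-sub imp imp′ iso
    with normalise 𝕂 𝕂′ K-sub K′-sub iso
  ... | iso₀@(f , _) , f0≡0 =
      f
    , additive⇒GL (additive 𝕂 𝕂′ K-sub K′-sub imp′ iso₀ f0≡0)
    , (λ {g} → conjugate-baseGroup 𝕂 𝕂′ K-sub K′-sub imp′ iso₀ f0≡0 {g})
    -- The opposite inclusion is the same argument for the inverse isomorphism, with rigidity now
    -- taken from `Cyc 𝕂 K`.
    , λ {g} g∈G′ → f ∙ g ∙ f ⁻¹
        , conjugate-baseGroup 𝕂′ 𝕂 K′-sub K-sub imp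
            (Isomorphic-sym {𝒞 = Cyc 𝕂 K} {Cyc 𝕂′ K′} iso₀)
            (trans (cong (from f) (sym f0≡0)) (strictlyInverseʳ f 0#))
            {f ∙ g ∙ f ⁻¹} (g , g∈G′ , λ _ → refl)
        , λ x → sym (trans (strictlyInverseˡ f _) (cong (to g) (strictlyInverseˡ f x)))
    where open Group (Sym V) using (_∙_; _⁻¹)

corollary3p6 : ∀ {ℓ} {V : Set ℓ} {_+_ : Op₂ V} {0# : V} { -_ : Op₁ V}
    {V⁺ : IsGroup _≡_ _+_ 0# -_} →
    Finite V →
    (𝕂 𝕂′ : NearField V⁺)
    (K : Pred (NearField.V≢0 𝕂) ℓ) → IsSubgroup (NearField.×-group 𝕂) K →
    (K′ : Pred (NearField.V≢0 𝕂′) ℓ) → IsSubgroup (NearField.×-group 𝕂′) K′ →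
    Imprimitive (Cyc 𝕂 K) → Imprimitive (Cyc 𝕂′ K′) →
    (Isomorphic (Cyc 𝕂 K) (Cyc 𝕂′ K′) ⇔
    ConjugateInGL V⁺ (baseGroup 𝕂 K) (baseGroup 𝕂′ K′))
    × IsLinearClosure V⁺ (baseGroup 𝕂 K) (baseGroup 𝕂 K)
    × Aut (Cyc 𝕂 K) ≐
    setProduct (Sym V) (translations V⁺) (baseGroup 𝕂 K)
corollary3p6 fin 𝕂 𝕂′ K K-sub K′ K′-sub imp imp′ =
    mk⇔ (isomorphic⇒conjugate 𝕂 𝕂′ K-sub K′-sub imp imp′)
        (conjugate⇒isomorphic 𝕂 𝕂′ K-sub K′-sub)
  , Rigidity.baseGroup-linearClosed
  , Rigidity.Aut≐affine
  where
  open Isomorphisms fin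
  module Rigidity = NearFieldProperties.Rigidity fin 𝕂 K-sub imp
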